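{- Let $G$ be any graph and let $n=|V(G)|$. Then $n+1\le \gamma_I(G\odot K_1)\le 2n$.
   Context: All graphs are finite, simple, undirected and have nonempty vertex set. $N(v)$ denotes the open neighborhood of a vertex $v$. An Italian dominating function (IDF) of a graph $G$ is a function $f:V(G)\to\{0,1,2\}$ such that every $v\in V(G)$ with $f(v)=0$ satisfies $\sum_{u\in N(v)}f(u)\ge 2$. Its weight is $\sum_{v\in V(G)}f(v)$, and the Italian domination number $\gamma_I(G)$ is the minimum weight of an IDF of $G$. The corona $G\odot K_1$ is the graph obtained from $G$ by attaching to each vertex of $G$ exactly one new pendent (degree-one) vertex. -}

module Defs where

open import Data.Empty using (⊥)
open import Data.Fin.Base using (Fin; zero; suc; toℕ; finToFun; funToFin)
open import Data.Fin.Properties as Fin using (all?; finToFun-funToFin; +↔⊎)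
open import Data.List.Base using (List; map; filter; tabulate; allFin)
open import Data.List.Extrema using (argmin; argmin-all; f[argmin]≤v⁺)
open import Data.List.Membership.Propositional using (_∈_; lose)
open import Data.List.Membership.Propositional.Properties using (∈-map⁺; ∈-filter⁺; ∈-allFin)
open import Data.List.Properties using (map-cong)
open import Data.List.Relation.Unary.All.Properties using (all-filter)
open import Data.Nat.Base using (ℕ; _+_; _^_; _≤_; NonZero; >-nonZero; >-nonZero⁻¹)
open import Data.Nat.ListAction using (sum)
open import Data.Nat.Properties using (_≤?_; ≤-totalOrder; ≤-reflexive; ≤-trans; m≤m+n)
open import Data.Product.Base using (∃; _×_; _,_; proj₁)
open import Data.Sum.Base using (_⊎_; inj₁; inj₂)
open import Data.Sum.Function.Propositional using (_⊎-↔_)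
open import Function.Base using (_∘_; const)
open import Function.Bundles using (_↔_; Inverse)
open import Function.Construct.Composition using (_↔-∘_)
open import Function.Construct.Symmetry using (↔-sym)
open import Relation.Binary.Definitions using (Decidable; DecidableEquality; Symmetric; Irreflexive)
open import Relation.Binary.PropositionalEquality using (_≡_; refl; sym; trans; cong; subst)
open import Relation.Nullary.Decidable using (Dec; no; map′; _→-dec_)

record Graph : Set₁ where
  field
    Vertex      : Set
    order       : ℕ
    enumeration : Vertex ↔ Fin order
    nonempty    : NonZero order
    Adj         : Vertex → Vertex → Set
    adj?        : Decidable Adj
    adj-sym     : Symmetric Adj
    adj-irrefl  : Irreflexive _≡_ Adj

  open Inverse enumeration public
    using () renaming (to to index; from to vertex; strictlyInverseʳ to vertex-index)

  vertices : List Vertex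
  vertices = tabulate vertex

  N : Vertex → List Vertex
  N v = filter (adj? v) vertices

  _≟ᵛ_ : DecidableEquality Vertex
  u ≟ᵛ v = map′
    (λ e → trans (sym (vertex-index u)) (trans (cong vertex e) (vertex-index v)))
    (cong index)
    (index u Fin.≟ index v)

module _ (G : Graph) where
  open Graph G

  Labelling : Set
  Labelling = Vertex → Fin 3

  IsIDF : Labelling → Set
  IsIDF f = ∀ v → f v ≡ zero → 2 ≤ sum (map (toℕ ∘ f) (N v))

  weight : Labelling → ℕ
  weight f = sum (map (toℕ ∘ f) vertices)

  record IsMinimumWeight (k : ℕ) : Set where
    field
      attained : ∃ λ f → IsIDF f × weight f ≡ k
      minimal  : ∀ f → IsIDF f → k ≤ weight f

  IsIDF? : ∀ f → Dec (IsIDF f)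
  IsIDF? f = map′
    (λ h v → subst Good (vertex-index v) (h (index v)))
    (λ h i → h (vertex i))
    (all? λ i → (f (vertex i) Fin.≟ zero) →-dec (2 ≤? sum (map (toℕ ∘ f) (N (vertex i)))))
    where
    Good : Vertex → Set
    Good v = f v ≡ zero → 2 ≤ sum (map (toℕ ∘ f) (N v))

  sum-cong : ∀ {f g : Labelling} → (∀ v → f v ≡ g v) →
             ∀ vs → sum (map (toℕ ∘ f) vs) ≡ sum (map (toℕ ∘ g) vs)
  sum-cong f≗g vs = cong sum (map-cong (λ v → cong toℕ (f≗g v)) vs)

  IsIDF-cong : ∀ {f g : Labelling} → (∀ v → f v ≡ g v) → IsIDF f → IsIDF g
  IsIDF-cong f≗g idf v gv≡0 =
    subst (2 ≤_) (sum-cong f≗g (N v)) (idf v (trans (f≗g v) gv≡0))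

  minimumWeight : ∃ IsMinimumWeight
  minimumWeight = weight best , record
    { attained = best , argmin-all ≤-totalOrder weight two-IDF (all-filter IsIDF? labellings) , refl
    ; minimal  = best-minimal
    }
    where
    decode : Fin (3 ^ order) → Labelling
    decode c = finToFun c ∘ index

    labellings : List Labelling
    labellings = map decode (allFin (3 ^ order))

    two : Labelling
    two = const (suc (suc zero))

    two-IDF : IsIDF two
    two-IDF v ()

    best : Labelling
    best = argmin ≤-totalOrder weight two (filter IsIDF? labellings)

    best-minimal : ∀ f → IsIDF f → weight best ≤ weight f
    best-minimal f idf = f[argmin]≤v⁺ ≤-totalOrder {f = weight} two (filter IsIDF? labellings)
      (inj₂ (lose g∈ (≤-reflexive (sum-cong (sym ∘ f≗g) vertices))))
      where
      g : Labelling
      g = decode (funToFin (f ∘ vertex))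

      f≗g : ∀ v → f v ≡ g v
      f≗g v = sym (trans (finToFun-funToFin (f ∘ vertex) (index v)) (cong f (vertex-index v)))

      g∈ : g ∈ filter IsIDF? labellings
      g∈ = ∈-filter⁺ IsIDF? (∈-map⁺ decode (∈-allFin _)) (IsIDF-cong f≗g idf)

  γI : ℕ
  γI = proj₁ minimumWeight

-- In the corona, inj₁ v is the vertex v of G, inj₂ v the pendent vertex
-- attached to it.
module _ (G : Graph) where
  open Graph G

  CoronaAdj : Vertex ⊎ Vertex → Vertex ⊎ Vertex → Set
  CoronaAdj (inj₁ u) (inj₁ v) = Adj u v
  CoronaAdj (inj₁ u) (inj₂ v) = u ≡ v
  CoronaAdj (inj₂ u) (inj₁ v) = u ≡ v
  CoronaAdj (inj₂ u) (inj₂ v) = ⊥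

  coronaAdj? : Decidable CoronaAdj
  coronaAdj? (inj₁ u) (inj₁ v) = adj? u v
  coronaAdj? (inj₁ u) (inj₂ v) = u ≟ᵛ v
  coronaAdj? (inj₂ u) (inj₁ v) = u ≟ᵛ v
  coronaAdj? (inj₂ u) (inj₂ v) = no λ ()

  coronaAdj-sym : Symmetric CoronaAdj
  coronaAdj-sym {inj₁ u} {inj₁ v} a = adj-sym a
  coronaAdj-sym {inj₁ u} {inj₂ v} e = sym e
  coronaAdj-sym {inj₂ u} {inj₁ v} e = sym e

  coronaAdj-irrefl : Irreflexive _≡_ CoronaAdj
  coronaAdj-irrefl {inj₁ u} refl a = adj-irrefl refl a

  _⊙K₁ : Graph
  _⊙K₁ = record
    { Vertex      = Vertex ⊎ Vertex
    ; order       = order + order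
    ; enumeration = ↔-sym +↔⊎ ↔-∘ (enumeration ⊎-↔ enumeration)
    ; nonempty    = >-nonZero (≤-trans (>-nonZero⁻¹ order {{nonempty}}) (m≤m+n order order))
    ; Adj         = CoronaAdj
    ; adj?        = coronaAdj?
    ; adj-sym     = λ {x} {y} → coronaAdj-sym {x} {y}
    ; adj-irrefl  = λ {x} {y} → coronaAdj-irrefl {x} {y}
    }

{-# OPTIONS --safe #-}
-- Let f be an IDF of G ⊙ K₁. If the pendent vertex at v has label 0, then its
-- only neighbour v has label 2, so v and its pendent vertex together always
-- weigh at least 1, which gives n. If each pair weighed exactly 1, every
-- vertex of G would have label 0 and every pendent vertex label 1, and a
-- vertex of G would see only the weight 1 of its pendent vertex. So the weight
-- exceeds n. The constant labelling 1 is an IDF of weight 2n.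
module Submission where

open import Algebra.Properties.CommutativeSemigroup using (interchange)
open import Data.Fin.Base using (Fin; zero; suc; toℕ; _↑ˡ_; _↑ʳ_; fromℕ<)
open import Data.Fin.Properties using (splitAt-↑ˡ; splitAt-↑ʳ; toℕ-injective)
open import Data.List.Base using (List; []; _∷_; _++_; map; length; tabulate)
open import Data.List.Membership.Propositional using (_∈_; lose)
open import Data.List.Membership.Propositional.Properties using (∈-tabulate⁺; ∈-filter⁻)
open import Data.List.Properties using (length-tabulate; map-++; map-∘; map-tabulate; tabulate-cong)
open import Data.List.Relation.Unary.All as All using (All; []; _∷_)
open import Data.List.Relation.Unary.Any using (Any; here; there; any?)
open import Data.List.Relation.Unary.AllPairs using ([]; _∷_)
open import Data.List.Relation.Unary.Unique.Propositional using (Unique)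
import Data.List.Relation.Unary.Unique.Propositional.Properties as Unique
open import Data.Nat.Base using (ℕ; zero; suc; _+_; _*_; _≤_; _<_; z≤n; s≤s; s≤s⁻¹; >-nonZero⁻¹)
open import Data.Nat.ListAction using (sum)
open import Data.Nat.ListAction.Properties using (sum-++)
open import Data.Nat.Properties
open import Data.Product.Base using (_×_; _,_; proj₂)
open import Data.Sum.Base using (_⊎_; inj₁; inj₂)
open import Defs using (Graph; Labelling; IsIDF; weight; IsMinimumWeight; minimumWeight; γI; _⊙K₁)
open import Function.Base using (_∘_; const)
open import Function.Bundles using (Injection)
open import Function.Construct.Symmetry using (↔-sym)
open import Function.Properties.Inverse using (↔⇒↣)
open import Relation.Binary.PropositionalEquality
open import Relation.Nullary.Decidable using (yes; no)
open import Relation.Nullary.Negation using (¬_; contradiction)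

module _ {A : Set} where

  sum-const : ∀ c (xs : List A) → sum (map (const c) xs) ≡ length xs * c
  sum-const c []       = refl
  sum-const c (_ ∷ xs) = cong (c +_) (sum-const c xs)

  sum-map-+ : ∀ (v w : A → ℕ) xs →
              sum (map (λ x → v x + w x) xs) ≡ sum (map v xs) + sum (map w xs)
  sum-map-+ v w []       = refl
  sum-map-+ v w (x ∷ xs) = trans
    (cong (v x + w x +_) (sum-map-+ v w xs))
    (interchange +-commutativeSemigroup (v x) (w x) _ _)

  -- Serves to cut the enumeration of the corona, indexed by `Fin (order + order)`, into original
  -- and pendent vertices.
  tabulate-+ : ∀ m {n} (g : Fin (m + n) → A) →
               tabulate g ≡ tabulate (g ∘ (_↑ˡ n)) ++ tabulate (g ∘ (m ↑ʳ_))
  tabulate-+ zero    g = refl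
  tabulate-+ (suc m) g = cong (g zero ∷_) (tabulate-+ m (g ∘ suc))

  module _ {w : A → ℕ} where

    sum-zero : ∀ {xs} → All (λ x → w x ≡ 0) xs → sum (map w xs) ≡ 0
    sum-zero []       = refl
    sum-zero (p ∷ ps) = cong₂ _+_ p (sum-zero ps)

    -- Without repetitions `u` occurs at most once, so at most one term is nonzero; equality can
    -- fail, since `u` may be absent. Applied to a neighbourhood, this turns the IDF condition into
    -- a bound on a single label.
    sum-supported : ∀ {u xs} → Unique xs → All (λ x → w x ≡ 0 ⊎ x ≡ u) xs →
                    sum (map w xs) ≤ w u
    sum-supported []         []               = z≤n
    sum-supported (_ ∷ uniq) (inj₁ wx≡0 ∷ ps) rewrite wx≡0 = sum-supported uniq ps
    sum-supported {u} (u≢ ∷ _) (inj₂ refl ∷ ps) =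
      ≤-reflexive (trans (cong (w u +_) (sum-zero (All.zipWith off-u (u≢ , ps)))) (+-identityʳ (w u)))
      where
      off-u : ∀ {x} → (¬ u ≡ x) × (w x ≡ 0 ⊎ x ≡ u) → w x ≡ 0
      off-u (_   , inj₁ wx≡0) = wx≡0
      off-u (u≢x , inj₂ x≡u)  = contradiction (sym x≡u) u≢x

    module _ (w≥1 : ∀ x → 1 ≤ w x) where

      length≤sum : ∀ xs → length xs ≤ sum (map w xs)
      length≤sum []       = z≤n
      length≤sum (x ∷ xs) = +-mono-≤ (w≥1 x) (length≤sum xs)

      length<sum : ∀ {xs} → Any (λ x → 2 ≤ w x) xs → length xs < sum (map w xs)
      length<sum {_ ∷ xs} (here wx≥2) = +-mono-≤ wx≥2 (length≤sum xs)
      length<sum {x ∷ _}  (there any) = +-mono-≤ (w≥1 x) (length<sum any)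

module _ (G : Graph) where
  open Graph G

  length-vertices : length vertices ≡ order
  length-vertices = length-tabulate vertex

  ∈-vertices : ∀ v → v ∈ vertices
  ∈-vertices v = subst (_∈ vertices) (vertex-index v) (∈-tabulate⁺ (index v))

  N-unique : ∀ v → Unique (N v)
  N-unique v = Unique.filter⁺ (adj? v)
    (Unique.tabulate⁺ (Injection.injective (↔⇒↣ (↔-sym enumeration))))

  N-adj : ∀ v → All (Adj v) (N v)
  N-adj v = All.tabulate (proj₂ ∘ ∈-filter⁻ (adj? v) {xs = vertices})

  someVertex : Vertex
  someVertex = vertex (fromℕ< (>-nonZero⁻¹ order {{nonempty}}))

  γI≤weight : ∀ f → IsIDF G f → γI G ≤ weight G f
  γI≤weight = IsMinimumWeight.minimal (proj₂ (minimumWeight G))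

  -- The constant labelling 1 is vacuously an IDF, as no vertex has label 0. Taking the corona for
  -- `G` gives the upper bound.
  γI≤order : γI G ≤ order
  γI≤order = begin
    γI G                         ≤⟨ γI≤weight (const (suc zero)) (λ _ ()) ⟩
    weight G (const (suc zero))  ≡⟨ sum-const 1 vertices ⟩
    length vertices * 1          ≡⟨ *-identityʳ _ ⟩
    length vertices              ≡⟨ length-vertices ⟩
    order                        ∎
    where open ≤-Reasoning

module _ (G : Graph) where
  open Graph G

  vertices-⊙K₁ : Graph.vertices (G ⊙K₁) ≡ map inj₁ vertices ++ map inj₂ vertices
  vertices-⊙K₁ = trans (tabulate-+ order corona-vertex) (cong₂ _++_
    (trans (tabulate-cong vertex-↑ˡ) (sym (map-tabulate vertex inj₁)))
    (trans (tabulate-cong vertex-↑ʳ) (sym (map-tabulate vertex inj₂))))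
    where
    corona-vertex : Fin (order + order) → Vertex ⊎ Vertex
    corona-vertex = Graph.vertex (G ⊙K₁)

    vertex-↑ˡ : ∀ i → corona-vertex (i ↑ˡ order) ≡ inj₁ (vertex i)
    vertex-↑ˡ i rewrite splitAt-↑ˡ order i order = refl

    vertex-↑ʳ : ∀ i → corona-vertex (order ↑ʳ i) ≡ inj₂ (vertex i)
    vertex-↑ʳ i rewrite splitAt-↑ʳ order order i = refl

  module _ (f : Labelling (G ⊙K₁)) where

    base pendent pair : Vertex → ℕ
    base    v = toℕ (f (inj₁ v))
    pendent v = toℕ (f (inj₂ v))
    pair    v = base v + pendent v

    -- Grouping each vertex with its pendent vertex lets the weight be bounded pair by pair.
    weight-⊙K₁ : weight (G ⊙K₁) f ≡ sum (map pair vertices)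
    weight-⊙K₁ = begin
      sum (map label (Graph.vertices (G ⊙K₁)))
        ≡⟨ cong (sum ∘ map label) vertices-⊙K₁ ⟩
      sum (map label (map inj₁ vertices ++ map inj₂ vertices))
        ≡⟨ cong sum (map-++ label (map inj₁ vertices) (map inj₂ vertices)) ⟩
      sum (map label (map inj₁ vertices) ++ map label (map inj₂ vertices))
        ≡⟨ sum-++ (map label (map inj₁ vertices)) _ ⟩
      sum (map label (map inj₁ vertices)) + sum (map label (map inj₂ vertices))
        ≡⟨ cong₂ (λ xs ys → sum xs + sum ys) (map-∘ vertices) (map-∘ vertices) ⟨
      sum (map base vertices) + sum (map pendent vertices)
        ≡⟨ sum-map-+ base pendent vertices ⟨
      sum (map pair vertices) ∎
      where
      open ≡-Reasoning
      label : Vertex ⊎ Vertex → ℕ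
      label = toℕ ∘ f

    module _ (idf : IsIDF (G ⊙K₁) f) where

      -- The pendent vertex has no neighbour besides `inj₁ v`, so the 2 it demands must come from
      -- that label alone.
      pendent≡0⇒base≥2 : ∀ v → pendent v ≡ 0 → 2 ≤ base v
      pendent≡0⇒base≥2 v p≡0 = ≤-trans (idf (inj₂ v) (toℕ-injective p≡0))
        (sum-supported (N-unique (G ⊙K₁) (inj₂ v)) (All.map (λ {x} → only-v x) (N-adj (G ⊙K₁) (inj₂ v))))
        where
        only-v : ∀ x → Graph.Adj (G ⊙K₁) (inj₂ v) x → toℕ (f x) ≡ 0 ⊎ x ≡ inj₁ v
        only-v (inj₁ u) v≡u = inj₂ (cong inj₁ (sym v≡u))

      pair≥1 : ∀ v → 1 ≤ pair v
      pair≥1 v with pendent v in eq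
      ... | zero  = ≤-trans (<⇒≤ (pendent≡0⇒base≥2 v eq)) (m≤m+n (base v) 0)
      ... | suc k = m≤n⇒m≤o+n (base v) (s≤s z≤n)

      -- A pendent label 0 would force `base v` to be at least 2; a positive one already uses up the
      -- whole allowance of 1.
      pair≤1⇒base≡0 : ∀ v → pair v ≤ 1 → base v ≡ 0
      pair≤1⇒base≡0 v p≤1 with pendent v in eq
      ... | zero  = contradiction (≤-trans (pendent≡0⇒base≥2 v eq) (m+n≤o⇒m≤o (base v) p≤1)) 1+n≰n
      ... | suc k = n≤0⇒n≡0 (m+n≤o⇒m≤o (base v) (s≤s⁻¹ (subst (_≤ 1) (+-suc (base v) k) p≤1)))

      -- The hypothesis covers all of `G`, so the neighbours of `v` in `G` contribute nothing and
      -- the demand of 2 at `v` falls on its pendent vertex.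
      base≡0⇒pendent≥2 : (∀ v → base v ≡ 0) → ∀ v → 2 ≤ pendent v
      base≡0⇒pendent≥2 base≡0 v = ≤-trans (idf (inj₁ v) (toℕ-injective (base≡0 v)))
        (sum-supported (N-unique (G ⊙K₁) (inj₁ v)) (All.map (λ {x} → only-pendent x) (N-adj (G ⊙K₁) (inj₁ v))))
        where
        only-pendent : ∀ x → Graph.Adj (G ⊙K₁) (inj₁ v) x → toℕ (f x) ≡ 0 ⊎ x ≡ inj₂ v
        only-pendent (inj₁ u) _   = inj₁ (base≡0 u)
        only-pendent (inj₂ u) v≡u = inj₂ (cong inj₂ (sym v≡u))

      some-pair≥2 : Any (λ v → 2 ≤ pair v) vertices
      some-pair≥2 with any? (λ v → 2 ≤? pair v) vertices
      ... | yes any = any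
      -- If every pair weighed at most 1, all labels on `G` would vanish, so the pendent vertex at
      -- `v₀` alone would make its pair weigh 2. Nonemptiness of `G` supplies `v₀`.
      ... | no ¬any = contradiction (lose (∈-vertices G v₀) (m≤n⇒m≤o+n (base v₀) pendent≥2)) ¬any
        where
        v₀ : Vertex
        v₀ = someVertex G

        base≡0 : ∀ v → base v ≡ 0
        base≡0 v = pair≤1⇒base≡0 v (s≤s⁻¹ (≰⇒> (¬any ∘ lose (∈-vertices G v))))

        pendent≥2 : 2 ≤ pendent v₀
        pendent≥2 = base≡0⇒pendent≥2 base≡0 v₀

      order<weight : order < weight (G ⊙K₁) f
      order<weight = subst₂ _<_ (length-vertices G) (sym weight-⊙K₁) (length<sum pair≥1 some-pair≥2)

  order<γI-⊙K₁ : order < γI (G ⊙K₁)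
  -- The minimum is the weight of an actual IDF, so the strict bound passes to it.
  order<γI-⊙K₁ with f , idf , weight≡γI ← IsMinimumWeight.attained (proj₂ (minimumWeight (G ⊙K₁))) =
    subst (order <_) weight≡γI (order<weight f idf)

theorem2p3 : (G : Graph) → let n = Graph.order G in (n + 1 ≤ γI (G ⊙K₁)) × (γI (G ⊙K₁) ≤ 2 * n)
theorem2p3 G =
  subst (_≤ γI (G ⊙K₁)) (+-comm 1 n) (order<γI-⊙K₁ G) ,
  -- `2 * n` computes to `n + (n + 0)`, while the order of the corona is `n + n`.
  subst (λ m → γI (G ⊙K₁) ≤ n + m) (sym (+-identityʳ n)) (γI≤order (G ⊙K₁))
  where n = Graph.order G
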